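{- For any real numbers $\alpha,\beta\ge 0$ with $2\alpha+\beta>1$, there exists $C>0$ such that the following holds. Let $G$ be an $n$-vertex graph admitting an edge coloring with $n$ colors, and let $\mathcal{F}=(F_1,\dots,F_n)$ be the family of color classes. Suppose that: (i) each color class is non-empty; (ii) there exists $\mathcal{F}_M\subseteq\mathcal{F}$ with $|\mathcal{F}_M|=\alpha n$ such that each color class in $\mathcal{F}_M$ contains a matching of size two; (iii) there exists $\mathcal{F}_S\subseteq\mathcal{F}\setminus\mathcal{F}_M$ with $|\mathcal{F}_S|=\beta n$ such that each color class in $\mathcal{F}_S$ contains a star of size two. Then the rainbow girth of $G$ is at most $C\log n$.
   Context: An edge coloring of a graph $G$ with $m$ colors is any map $\lambda:E(G)\to[m]$ (not necessarily proper); for $i\in[m]$ the set $\lambda^{ -1}(i)$ is a color class. A subgraph of $G$ is rainbow if no two of its edges lie in the same color class. The rainbow girth of $G$ is the minimum length of a rainbow cycle in $G$ ($\infty$ if none exists). A star of size two is a pair of distinct edges sharing a vertex; a matching of size two is a pair of vertex-disjoint edges. -}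

module Defs where

open import Data.Nat as ℕ using (ℕ; suc; _≤_)
open import Data.Nat.DivMod using (_mod_)
open import Data.Fin using (Fin; toℕ)
open import Data.Fin.Subset using (Subset; _∈_; _∉_; ∣_∣)
open import Data.Product using (Σ; ∃; ∃-syntax; _×_)
open import Data.Sum using (_⊎_)
open import Data.Integer using (+_)
open import Data.Rational using (ℚ; _/_)
open import Function using (_∘_)
open import Function.Definitions using (Injective)
open import Relation.Binary.PropositionalEquality using (_≡_; _≢_)

record Graph (n : ℕ) : Set where
  field
    m        : ℕ
    end₁     : Fin m → Fin n
    end₂     : Fin m → Fin n
    loopless : ∀ e → end₁ e ≢ end₂ e
    simple   : ∀ e f →
               ((end₁ e ≡ end₁ f × end₂ e ≡ end₂ f) ⊎
                (end₁ e ≡ end₂ f × end₂ e ≡ end₁ f)) → e ≡ f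
open Graph public

Coloring : ∀ {n} → Graph n → ℕ → Set
Coloring G k = Fin (m G) → Fin k

Joins : ∀ {n} (G : Graph n) → Fin (m G) → Fin n → Fin n → Set
Joins G e u v = (end₁ G e ≡ u × end₂ G e ≡ v) ⊎ (end₁ G e ≡ v × end₂ G e ≡ u)

Incident : ∀ {n} (G : Graph n) → Fin n → Fin (m G) → Set
Incident G v e = (end₁ G e ≡ v) ⊎ (end₂ G e ≡ v)

next : ∀ {j} → Fin (suc j) → Fin (suc j)
next {j} i = suc (toℕ i) mod (suc j)

record RainbowCycle {n k} (G : Graph n) (c : Coloring G k) (L : ℕ) : Set where
  field
    j        : ℕ
    len      : L ≡ suc j
    long     : 3 ≤ L
    vs       : Fin (suc j) → Fin n
    vs-inj   : Injective _≡_ _≡_ vs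
    es       : Fin (suc j) → Fin (m G)
    joins    : ∀ i → Joins G (es i) (vs i) (vs (next i))
    rainbow  : Injective _≡_ _≡_ (c ∘ es)

HasMatching2 : ∀ {n k} (G : Graph n) → Coloring G k → Fin k → Set
HasMatching2 G c i = Σ (Fin (m G)) λ e → Σ (Fin (m G)) λ f →
  c e ≡ i × c f ≡ i ×
  end₁ G e ≢ end₁ G f × end₁ G e ≢ end₂ G f ×
  end₂ G e ≢ end₁ G f × end₂ G e ≢ end₂ G f

HasStar2 : ∀ {n k} (G : Graph n) → Coloring G k → Fin k → Set
HasStar2 G c i = Σ (Fin (m G)) λ e → Σ (Fin (m G)) λ f →
  c e ≡ i × c f ≡ i × e ≢ f × ∃[ v ] (Incident G v e × Incident G v f)

ℕ→ℚ : ℕ → ℚ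
ℕ→ℚ k = (+ k) / 1

module Submission where

open import Defs
open import Data.Nat using (ℕ; zero; suc; _+_; _*_; _^_; _%_; _≤_; _<_; _>_; _≥_; z≤n; s≤s; NonZero; _≤?_; _<?_)
open import Data.Nat.Properties hiding (_≟_; _≤?_; _<?_)
open import Data.Nat.Logarithm using (⌊log₂_⌋; ⌊log₂⌋-mono-≤; ⌊log₂[2^n]⌋≡n)
open import Data.Nat.DivMod using (m<n⇒m%n≡m; n%n≡0)
open import Data.Nat.Coprimality using (Coprime)
open import Data.Nat.Tactic.RingSolver using (solve-∀)
open import Data.Fin using (Fin; zero; suc; fromℕ; inject₁)
open import Data.Fin.Properties using (_≟_; any?; toℕ-injective; toℕ-fromℕ<; toℕ-fromℕ; toℕ-inject₁; inject₁ℕ<)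
open import Data.Fin.Relation.Unary.Top using (view; ‵fromℕ; ‵inject₁)
open import Data.Fin.Subset using (Subset; _∈_; _∉_; ∣_∣; inside; outside)
open import Data.Fin.Subset.Properties using (_∈?_)
open import Data.Vec using ([]; _∷_)
open import Data.List using (List; []; _∷_; allFin)
open import Data.List.Relation.Unary.All as All using (All; []; _∷_; lookup)
open import Data.List.Membership.Propositional.Properties using (∈-allFin)
open import Data.Product using (∃; ∃-syntax; Σ-syntax; _×_; _,_; proj₁; proj₂; map₂)
open import Data.Sum using (_⊎_; inj₁; inj₂; [_,_]′) renaming (map to map-⊎)
open import Data.Empty using (⊥)
open import Data.Unit using (⊤; tt)
import Data.Integer as ℤ
import Data.Integer.Properties as ℤₚ
import Data.Rational as ℚ
import Data.Rational.Properties as ℚₚ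
import Data.Rational.Unnormalised as ℚᵘ
import Data.Rational.Unnormalised.Properties as ℚᵘₚ
open import Data.Rational using (ℚ; 0ℚ; 1ℚ) renaming (_≤_ to _≤ℚ_; _<_ to _<ℚ_; _+_ to _+ℚ_; _*_ to _*ℚ_)
open import Function using (_∘_; id; case_of_)
open import Function.Definitions using (Injective)
open import Level using (0ℓ)
open import Relation.Nullary using (Dec; yes; no; ¬_; contradiction)
open import Relation.Nullary.Decidable using (¬?; _×-dec_; _⊎-dec_)
open import Relation.Unary using (Pred; Decidable)
open import Relation.Binary.PropositionalEquality using (_≡_; _≢_; refl; sym; trans; cong; cong₂; subst; subst₂; module ≡-Reasoning)
open import Algebra.Properties.Semiring.Sum +-*-semiring using (sum; sum-cong-≗; ∑-distrib-+; ∑-comm; *-distribˡ-sum; *-distribʳ-sum)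

-- Two edges of each colour are fixed, disjoint ones for a matching and equal ones for a class that
-- is only known to be non-empty. Counting, for every colour, the common ends of its two edges gives at
-- most n * 2 - (2 * ∣FM∣ + ∣FS∣), which is at most (1 - ε) n. Hence linearly many vertices are not a
-- common end for any colour and have bounded degree among the chosen edges, and greedily one finds
-- linearly many of them, D, such that no colour has both its edges meeting D. Deleting D leaves a
-- rainbow graph with n edges on at most (1 - δ) n vertices.
--
-- In a graph with n vertices and more than (1 + 1/q) n edges, grow a ball. As long as no short cycle
-- closes, the next ball is a tree containing all edges that touch the current one. Either the balls
-- grow by a factor 1 + 1/q, which can last only O(q log n) steps, or some ball B is touched by
-- at most (1 + 1/q) |B| edges, and deleting it preserves the density.

-- Counting by sums of indicators

𝟙 : {P : Set} → Dec P → ℕ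
𝟙 (yes _) = 1
𝟙 (no _)  = 0

𝟙-elim : ∀ {P : Set} (P? : Dec P) {k} → (P → 1 ≤ k) → 𝟙 P? ≤ k
𝟙-elim (yes p) f = f p
𝟙-elim (no _)  f = z≤n

𝟙-intro : ∀ {P : Set} (P? : Dec P) → P → 1 ≤ 𝟙 P?
𝟙-intro (yes _) p = ≤-refl
𝟙-intro (no ¬p) p = contradiction p ¬p

𝟙-¬ : ∀ {P : Set} (P? : Dec P) → 𝟙 P? + 𝟙 (¬? P?) ≡ 1
𝟙-¬ (yes _) = refl
𝟙-¬ (no _)  = refl

𝟙-disjoint : ∀ {P Q : Set} (P? : Dec P) (Q? : Dec Q) {k} →
             (P → Q → 2 ≤ k) → (P ⊎ Q → 1 ≤ k) → 𝟙 P? + 𝟙 Q? ≤ k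
𝟙-disjoint (yes p) (yes q) f g = f p q
𝟙-disjoint (yes p) (no _)  f g = g (inj₁ p)
𝟙-disjoint (no _)  (yes q) f g = g (inj₂ q)
𝟙-disjoint (no _)  (no _)  f g = z≤n

sum-mono : ∀ {n} {f g : Fin n → ℕ} → (∀ i → f i ≤ g i) → sum f ≤ sum g
sum-mono {zero}  h = z≤n
sum-mono {suc n} h = +-mono-≤ (h zero) (sum-mono (h ∘ suc))

sum-const : ∀ n k → sum {n} (λ _ → k) ≡ n * k
sum-const zero    k = refl
sum-const (suc n) k = cong (k +_) (sum-const n k)

term≤sum : ∀ {n} (f : Fin n → ℕ) i → f i ≤ sum f
term≤sum f zero    = m≤m+n _ _
term≤sum f (suc i) = ≤-trans (term≤sum (f ∘ suc) i) (m≤n+m _ (f zero))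

count : ∀ {n} {P : Pred (Fin n) 0ℓ} → Decidable P → ℕ
count P? = sum (λ i → 𝟙 (P? i))

count-single : ∀ {n} (x : Fin n) → count (_≟ x) ≡ 1
count-single {suc n} zero    = cong suc (trans (sum-const n 0) (*-zeroʳ n))
count-single {suc n} (suc x) = trans (sum-cong-≗ lemma) (count-single x)
  where
  lemma : ∀ i → 𝟙 (suc i ≟ suc x) ≡ 𝟙 (i ≟ x)
  lemma i with i ≟ x
  ... | yes _ = refl
  ... | no _  = refl

module _ {n} {P : Pred (Fin n) 0ℓ} (P? : Decidable P) where

  count-≤ : count P? ≤ n
  count-≤ = ≤-trans (sum-mono (λ i → 𝟙-elim (P? i) (λ _ → ≤-refl)))
                    (≤-reflexive (trans (sum-const n 1) (*-identityʳ n)))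

  count-inhabited : ∀ {i} → P i → 1 ≤ count P?
  count-inhabited {i} p = ≤-trans (𝟙-intro (P? i) p) (term≤sum (λ j → 𝟙 (P? j)) i)

  count-none : (∀ i → ¬ P i) → count P? ≡ 0
  count-none ¬p = n≤0⇒n≡0 (≤-trans (sum-mono (λ i → 𝟙-elim (P? i) (λ p → contradiction p (¬p i))))
                                   (≤-reflexive (trans (sum-const n 0) (*-zeroʳ n))))

  count-witness : 1 ≤ count P? → ∃ P
  count-witness 1≤ with any? P?
  ... | yes w = w
  ... | no ¬w = contradiction (subst (1 ≤_) (count-none (λ i p → ¬w (i , p))) 1≤) λ ()

  count-¬ : count P? + count (λ i → ¬? (P? i)) ≡ n
  count-¬ = trans (sym (∑-distrib-+ (λ i → 𝟙 (P? i)) (λ i → 𝟙 (¬? (P? i)))))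
           (trans (sum-cong-≗ (λ i → 𝟙-¬ (P? i)))
           (trans (sum-const n 1) (*-identityʳ n)))

  count-all : (∀ i → P i) → n ≤ count P?
  count-all p = ≤-trans (≤-reflexive (sym (trans (sum-const n 1) (*-identityʳ n))))
                        (sum-mono (λ i → 𝟙-intro (P? i) (p i)))

  count-mono : {Q : Pred (Fin n) 0ℓ} (Q? : Decidable Q) → (∀ i → P i → Q i) → count P? ≤ count Q?
  count-mono Q? h = sum-mono (λ i → 𝟙-elim (P? i) (𝟙-intro (Q? i) ∘ h i))

  count-split : {Q R : Pred (Fin n) 0ℓ} (Q? : Decidable Q) (R? : Decidable R) →
                (∀ i → P i → Q i ⊎ R i) → count P? ≤ count Q? + count R?
  count-split Q? R? h = ≤-trans
    (sum-mono (λ i → 𝟙-elim (P? i) (λ p →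
      [ (λ x → ≤-trans (𝟙-intro (Q? i) x) (m≤m+n _ _)) , (λ x → ≤-trans (𝟙-intro (R? i) x) (m≤n+m _ (𝟙 (Q? i)))) ]′ (h i p))))
    (≤-reflexive (∑-distrib-+ (λ i → 𝟙 (Q? i)) (λ i → 𝟙 (R? i))))

  -- As `𝟙` never exceeds 1, the first hypothesis can hold only vacuously: it is the disjointness of
  -- `Q` and `R`, in the form that the pointwise comparison consumes.
  count-disjoint : {Q R : Pred (Fin n) 0ℓ} (Q? : Decidable Q) (R? : Decidable R) →
                   (∀ i → Q i → R i → 2 ≤ 𝟙 (P? i)) → (∀ i → Q i ⊎ R i → P i) →
                   count Q? + count R? ≤ count P?
  count-disjoint Q? R? h g = ≤-trans
    (≤-reflexive (sym (∑-distrib-+ (λ i → 𝟙 (Q? i)) (λ i → 𝟙 (R? i)))))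
    (sum-mono (λ i → 𝟙-disjoint (Q? i) (R? i) (h i) (𝟙-intro (P? i) ∘ g i)))

-- Rainbow cycles from walks

module _ {n} (H : Graph n) where

  Joins-sym : ∀ {e u v} → Joins H e u v → Joins H e v u
  Joins-sym (inj₁ (p , q)) = inj₂ (p , q)
  Joins-sym (inj₂ (p , q)) = inj₁ (p , q)

  Joins-irrefl : ∀ {e u} → ¬ Joins H e u u
  Joins-irrefl {e} (inj₁ (p , q)) = loopless H e (trans p (sym q))
  Joins-irrefl {e} (inj₂ (p , q)) = loopless H e (trans p (sym q))

  Joins-unique : ∀ {e f u v} → Joins H e u v → Joins H f u v → e ≡ f
  Joins-unique (inj₁ (refl , refl)) (inj₁ (p , q)) = simple H _ _ (inj₁ (sym p , sym q))
  Joins-unique (inj₁ (refl , refl)) (inj₂ (p , q)) = simple H _ _ (inj₂ (sym q , sym p))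
  Joins-unique (inj₂ (refl , refl)) (inj₁ (p , q)) = simple H _ _ (inj₂ (sym q , sym p))
  Joins-unique (inj₂ (refl , refl)) (inj₂ (p , q)) = simple H _ _ (inj₁ (sym p , sym q))

  -- The target `y` is a parameter and the source `x` an index, so a walk from `x` to `y` grows at
  -- its source.
  data Walk (T : Pred (Fin (m H)) 0ℓ) (y : Fin n) : Fin n → ℕ → Set where
    nil  : Walk T y y 0
    cons : ∀ {x z k} e → T e → Joins H e x z → Walk T y z k → Walk T y x (suc k)

  module _ {T : Pred (Fin (m H)) 0ℓ} where

    _++ʷ_ : ∀ {x y z k l} → Walk T y x k → Walk T z y l → Walk T z x (k + l)
    nil ++ʷ q = q
    cons e t j p ++ʷ q = cons e t j (p ++ʷ q)

    reverseʷ : ∀ {x y k} → Walk T y x k → Walk T x y k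
    reverseʷ nil = nil
    reverseʷ {x} (cons {k = k} e t j p) =
      subst (Walk T x _) (+-comm k 1) (reverseʷ p ++ʷ cons e t (Joins-sym j) nil)

    mapʷ : ∀ {T′ : Pred (Fin (m H)) 0ℓ} → (∀ e → T e → T′ e) → ∀ {x y k} → Walk T y x k → Walk T′ y x k
    mapʷ h nil = nil
    mapʷ h (cons e t j p) = cons e (h e t) j (mapʷ h p)

    at : ∀ {x y k} → Walk T y x k → Fin (suc k) → Fin n
    at {x} p              zero    = x
    at     (cons e t j p) (suc i) = at p i

    at-last : ∀ {x y k} (p : Walk T y x k) → at p (fromℕ k) ≡ y
    at-last nil            = refl
    at-last (cons e t j p) = at-last p

    Simple : ∀ {x y k} → Walk T y x k → Set
    Simple nil                = ⊤
    Simple {x} (cons e t j p) = (∀ i → at p i ≢ x) × Simple p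

    at-injective : ∀ {x y k} (p : Walk T y x k) → Simple p → Injective _≡_ _≡_ (at p)
    at-injective p              s       {zero}  {zero}   _  = refl
    at-injective (cons e t j p) (a , s) {zero}  {suc i′} eq = contradiction (sym eq) (a i′)
    at-injective (cons e t j p) (a , s) {suc i} {zero}   eq = contradiction eq (a i)
    at-injective (cons e t j p) (a , s) {suc i} {suc i′} eq = cong suc (at-injective p s eq)

    SimpleWalk≤ : Fin n → Fin n → ℕ → Set
    SimpleWalk≤ y x k = ∃[ l ] (l ≤ k × Σ[ p ∈ Walk T y x l ] Simple p)

    suffix : ∀ {x y k} (p : Walk T y x k) → Simple p → ∀ i → SimpleWalk≤ y (at p i) k
    suffix p s zero = _ , ≤-refl , p , s
    suffix (cons e t j p) (a , s) (suc i) with l , l≤ , q , sq ← suffix p s i = l , m≤n⇒m≤1+n l≤ , q , sq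

    -- Loop erasure, starting from the target: if `x` reappears on the simplified rest, only the
    -- suffix from there is kept.
    simplify : ∀ {x y k} → Walk T y x k → SimpleWalk≤ y x k
    simplify nil = 0 , ≤-refl , nil , tt
    simplify {x} (cons e t j p) with l , l≤ , q , sq ← simplify p with any? (λ i → at q i ≟ x)
    ... | no ¬i = suc l , s≤s l≤ , cons e t j q , (λ i eq → ¬i (i , eq)) , sq
    ... | yes (i , refl) with l′ , l′≤ , q′ , sq′ ← suffix q sq i = l′ , ≤-trans l′≤ (m≤n⇒m≤1+n l≤) , q′ , sq′

    -- A cycle has as many edges as vertices, so edges are indexed like vertices, with the closing
    -- edge `f` in the last place.
    closedBy : ∀ {x y k} → Walk T y x k → Fin (m H) → Fin (suc k) → Fin (m H)
    closedBy nil            f i       = f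
    closedBy (cons e t j p) f zero    = e
    closedBy (cons e t j p) f (suc i) = closedBy p f i

    closedBy-last : ∀ {x y k} (p : Walk T y x k) f → closedBy p f (fromℕ k) ≡ f
    closedBy-last nil            f = refl
    closedBy-last (cons e t j p) f = closedBy-last p f

    closedBy-joins : ∀ {x y k} (p : Walk T y x k) f i →
                     Joins H (closedBy p f (inject₁ i)) (at p (inject₁ i)) (at p (suc i))
    closedBy-joins (cons e t j p) f zero    = j
    closedBy-joins (cons e t j p) f (suc i) = closedBy-joins p f i

    closedBy-edge : ∀ {x y k} (p : Walk T y x k) f i → closedBy p f i ≡ f ⊎
      (T (closedBy p f i) × ∀ {u v} → Joins H (closedBy p f i) u v → ∃[ i′ ] at p i′ ≡ u)
    closedBy-edge nil f i = inj₁ refl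
    closedBy-edge (cons e t (inj₁ (refl , refl)) p) f zero = inj₂ (t , λ where
      (inj₁ (refl , _)) → zero , refl
      (inj₂ (_ , refl)) → suc zero , refl)
    closedBy-edge (cons e t (inj₂ (refl , refl)) p) f zero = inj₂ (t , λ where
      (inj₁ (refl , _)) → suc zero , refl
      (inj₂ (_ , refl)) → zero , refl)
    closedBy-edge (cons e t j p) f (suc i) with closedBy-edge p f i
    ... | inj₁ eq      = inj₁ eq
    ... | inj₂ (t′ , h) = inj₂ (t′ , λ j′ → let i′ , eq = h j′ in suc i′ , eq)

    -- The first edge of a simple walk cannot recur: every later edge of the walk has both ends on
    -- the rest of the walk, which avoids the starting vertex, and the closing edge lies outside
    -- `T`.
    closedBy-injective : ∀ {x y k} (p : Walk T y x k) f → Simple p → ¬ T f →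
                         Injective _≡_ _≡_ (closedBy p f)
    closedBy-injective nil f s ¬t {zero} {zero} eq = refl
    closedBy-injective (cons e t j p) f (a , s) ¬t {zero} {zero} eq = refl
    closedBy-injective (cons e t j p) f (a , s) ¬t {suc i} {suc i′} eq =
      cong suc (closedBy-injective p f s ¬t eq)
    closedBy-injective (cons e t j p) f (a , s) ¬t {zero} {suc i′} eq with closedBy-edge p f i′
    ... | inj₁ eq′    = contradiction (subst T (trans eq eq′) t) ¬t
    ... | inj₂ (_ , h) = let i , eq″ = h (subst (λ e → Joins H e _ _) eq j) in contradiction eq″ (a i)
    closedBy-injective (cons e t j p) f (a , s) ¬t {suc i} {zero} eq with closedBy-edge p f i
    ... | inj₁ eq′    = contradiction (subst T (trans (sym eq) eq′) t) ¬t
    ... | inj₂ (_ , h) = let i , eq″ = h (subst (λ e → Joins H e _ _) (sym eq) j) in contradiction eq″ (a i)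

    next-inject₁ : ∀ {k} (i : Fin k) → next (inject₁ i) ≡ suc i
    next-inject₁ {k} i = toℕ-injective (trans (toℕ-fromℕ< _)
      (trans (m<n⇒m%n≡m (s≤s (inject₁ℕ< i))) (cong suc (toℕ-inject₁ i))))

    next-fromℕ : ∀ k → next (fromℕ k) ≡ zero
    next-fromℕ k = toℕ-injective (trans (toℕ-fromℕ< _)
      (trans (cong (λ t → suc t % suc k) (toℕ-fromℕ k)) (n%n≡0 (suc k))))

    -- `f` is not a loop, and beside a single edge it would be parallel, hence equal to that edge
    -- and in `T`.
    cycle-length≥3 : ∀ {x y k} → Walk T y x k → ∀ f → Joins H f y x → ¬ T f → 2 ≤ k
    cycle-length≥3 nil f j ¬t = contradiction j Joins-irrefl
    cycle-length≥3 (cons e t j nil) f j′ ¬t =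
      contradiction (subst T (Joins-unique (Joins-sym j) j′) t) ¬t
    cycle-length≥3 (cons _ _ _ (cons _ _ _ _)) f j ¬t = s≤s (s≤s z≤n)

    -- Under the colouring `id`, rainbow means having distinct edges, so this yields ordinary
    -- cycles. Loop erasure may shorten the walk, hence only a bound on `L`.
    close : ∀ {x y k} → Walk T y x k → ∀ f → Joins H f y x → ¬ T f →
            ∃[ L ] (L ≤ suc k × RainbowCycle H id L)
    close {x} {y} w f j ¬t with l , l≤ , p , s ← simplify w = suc l , s≤s l≤ , record
      { j       = l
      ; len     = refl
      ; long    = s≤s (cycle-length≥3 p f j ¬t)
      ; vs      = at p
      ; vs-inj  = at-injective p s
      ; es      = closedBy p f
      ; joins   = cyclic
      ; rainbow = closedBy-injective p f s ¬t
      }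
      where
      cyclic : ∀ i → Joins H (closedBy p f i) (at p i) (at p (next i))
      cyclic i with view i
      ... | ‵inject₁ i′ rewrite next-inject₁ i′ = closedBy-joins p f i′
      ... | ‵fromℕ rewrite next-fromℕ l | closedBy-last p f | at-last p = j

-- Ball growing

module _ {n} (H : Graph n) where

  ShortCycle : ℕ → Set
  ShortCycle k = ∃[ L ] (L ≤ k × RainbowCycle H id L)

  Touches : Pred (Fin n) 0ℓ → Pred (Fin (m H)) 0ℓ
  Touches B e = B (end₁ H e) ⊎ B (end₂ H e)

  -- Two consequences of being a tree of depth `d` are recorded: `size` drives the growth of balls,
  -- and `reach` closes cycles through the root.
  record Tree (V : Pred (Fin n) 0ℓ) (r : Fin n) (d : ℕ) : Set₁ where
    field
      B     : Pred (Fin n) 0ℓ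
      B?    : Decidable B
      B⊆V   : ∀ u → B u → V u
      T     : Pred (Fin (m H)) 0ℓ
      T?    : Decidable T
      size  : suc (count T?) ≤ count B?
      reach : ∀ u → B u → ∃[ k ] (k ≤ d × Walk H T r u k)

  open Tree

  singleton-tree : ∀ {V} r → V r → Tree V r 0
  singleton-tree r v = record
    { B     = _≡ r
    ; B?    = _≟ r
    ; B⊆V   = λ { u refl → v }
    ; T     = λ _ → ⊥
    ; T?    = λ _ → no λ ()
    ; size  = ≤-trans (s≤s (≤-reflexive (trans (sum-const (m H) 0) (*-zeroʳ (m H)))))
                      (≤-reflexive (sym (count-single r)))
    ; reach = λ { u refl → 0 , z≤n , nil }
    }

  -- An edge outside the tree that joins two vertices of depth at most d closes a cycle through the root.
  tree-cycle : ∀ {V r d} (t : Tree V r d) {e u v} → Joins H e u v → ¬ T t e → B t u → B t v →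
               ShortCycle (suc (d + d))
  tree-cycle t {e} j ¬e bu bv
    with k , k≤ , p ← reach t _ bu | l , l≤ , q ← reach t _ bv
    with L , L≤ , cyc ← close H (_++ʷ_ H q (reverseʷ H p)) e j ¬e =
      L , ≤-trans L≤ (s≤s (+-mono-≤ l≤ k≤)) , cyc

  module _ {V : Pred (Fin n) 0ℓ} {E : Pred (Fin (m H)) 0ℓ} (E? : Decidable E)
           (ends : ∀ {e u v} → E e → Joins H e u v → V v) {r : Fin n} {d : ℕ} (t : Tree V r d) where

    -- The next layer after processing the edges `es`. `covers` refers to the ball of the fixed `t`
    -- rather than to that of the growing `tree`, so the depth rises by one only.
    record Extension (es : List (Fin (m H))) : Set₁ where
      field
        tree   : Tree V r (suc d)
        B-grow : ∀ u → B t u → B tree u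
        T-grow : ∀ e → T t e → T tree e
        covers : All (λ e → E e → Touches (B t) e → T tree e) es

    open Extension

    touches? : Decidable (Touches (B t))
    touches? e = B? t (end₁ H e) ⊎-dec B? t (end₂ H e)

    skip : ∀ {e es} (x : Extension es) → (E e → Touches (B t) e → T (tree x) e) → Extension (e ∷ es)
    skip x h = record { tree = tree x ; B-grow = B-grow x ; T-grow = T-grow x ; covers = h ∷ covers x }

    attach : ∀ {e es u v} (x : Extension es) → ¬ T (tree x) e → Joins H e u v → E e → B t u →
             ¬ B (tree x) v → Extension (e ∷ es)
    attach {e} {es} {u} {v} x ¬e j ee bu ¬v = record
      { tree = record
          { B     = λ w → B s w ⊎ w ≡ v
          ; B?    = B′?
          ; B⊆V   = λ { w (inj₁ b) → B⊆V s w b ; w (inj₂ refl) → ends ee j }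
          ; T     = λ f → T s f ⊎ f ≡ e
          ; T?    = T′?
          ; size  = begin
              suc (count T′?)                 ≤⟨ s≤s (count-split T′? (T? s) (_≟ e) (λ _ → id)) ⟩
              suc (count (T? s) + count (_≟ e)) ≡⟨ cong (λ k → suc (count (T? s) + k)) (count-single e) ⟩
              suc (count (T? s)) + 1          ≤⟨ +-monoˡ-≤ 1 (size s) ⟩
              count (B? s) + 1                ≡⟨ cong (count (B? s) +_) (count-single v) ⟨
              count (B? s) + count (_≟ v)     ≤⟨ count-disjoint B′? (B? s) (_≟ v) (λ { _ b refl → contradiction b ¬v }) (λ _ → id) ⟩
              count B′?                       ∎
          ; reach = λ { w (inj₁ b) → let k , k≤ , p = reach s w b in k , k≤ , mapʷ H (λ _ → inj₁) p
                      -- The walk to `v` passes through the old tree `t`, where `u` has depth at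
                      -- most `d`; in `s` the bound would be `suc d`.
                      ; w (inj₂ refl) → let k , k≤ , p = reach t u bu in
                          suc k , s≤s k≤ , cons e (inj₂ refl) (Joins-sym H j) (mapʷ H (λ f → inj₁ ∘ T-grow x f) p) }
          }
      ; B-grow = λ w → inj₁ ∘ B-grow x w
      ; T-grow = λ f → inj₁ ∘ T-grow x f
      ; covers = (λ _ _ → inj₂ refl) ∷ All.map (λ h e′ b → inj₁ (h e′ b)) (covers x)
      }
      where
      open ≤-Reasoning
      s = tree x
      B′? : Decidable (λ w → B s w ⊎ w ≡ v)
      B′? w = B? s w ⊎-dec (w ≟ v)
      T′? : Decidable (λ f → T s f ⊎ f ≡ e)
      T′? f = T? s f ⊎-dec (f ≟ e)

    add-edge : ∀ {e es u v} (x : Extension es) → ¬ T (tree x) e → Joins H e u v → E e → B t u →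
               ShortCycle (suc (suc d + suc d)) ⊎ Extension (e ∷ es)
    add-edge {v = v} x ¬e j ee bu with B? (tree x) v
    ... | yes bv = inj₁ (tree-cycle (tree x) j ¬e (B-grow x _ bu) bv)
    ... | no ¬bv = inj₂ (attach x ¬e j ee bu ¬bv)

    extend : ∀ es → ShortCycle (suc (suc d + suc d)) ⊎ Extension es
    extend [] = inj₂ record
      { tree   = record { B = B t ; B? = B? t ; B⊆V = B⊆V t ; T = T t ; T? = T? t ; size = size t
                        ; reach = λ u b → let k , k≤ , p = reach t u b in k , m≤n⇒m≤1+n k≤ , p }
      ; B-grow = λ _ → id
      ; T-grow = λ _ → id
      ; covers = []
      }
    extend (e ∷ es) with extend es
    ... | inj₁ c = inj₁ c
    ... | inj₂ x with T? (tree x) e | E? e | touches? e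
    ... | yes te | _      | _             = inj₂ (skip x (λ _ _ → te))
    ... | no _   | no ¬ee | _             = inj₂ (skip x (λ ee → contradiction ee ¬ee))
    ... | no _   | yes _  | no ¬b         = inj₂ (skip x (λ _ b → contradiction b ¬b))
    ... | no ¬te | yes ee | yes (inj₁ b₁) = add-edge x ¬te (inj₁ (refl , refl)) ee b₁
    ... | no ¬te | yes ee | yes (inj₂ b₂) = add-edge x ¬te (inj₂ (refl , refl)) ee b₂

    boundary? : Decidable (λ e → E e × Touches (B t) e)
    boundary? e = E? e ×-dec touches? e

    -- Once all edges are processed, every edge of `E` touching the ball belongs to the new tree,
    -- which has more vertices than edges.
    next-layer : ShortCycle (suc (suc d + suc d)) ⊎
                 Σ[ t′ ∈ Tree V r (suc d) ] suc (count boundary?) ≤ count (B? t′)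
    next-layer with extend (allFin (m H))
    ... | inj₁ c = inj₁ c
    ... | inj₂ x = inj₂ (tree x , ≤-trans
        (s≤s (count-mono boundary? (T? (tree x)) (λ { e (ee , b) → lookup (covers x) (∈-allFin e) ee b })))
        (size (tree x)))

  module _ (q R : ℕ) (q^R*n<[1+q]^R : q ^ R * n < suc q ^ R) where

    -- The invariant, cleared of denominators, is that the ball at depth `d` has at least (1 +
    -- 1/q)^d vertices. By the choice of `R` this is impossible at depth `R`, so earlier a cycle
    -- closes or a ball is touched by few edges.
    grow : ∀ {V E r d} (E? : Decidable E) → (∀ {e u v} → E e → Joins H e u v → V v) →
           ∀ fuel → fuel + d ≡ R → (t : Tree V r d) → suc q ^ d ≤ q ^ d * count (B? t) →
           ShortCycle (suc (R + R)) ⊎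
           Σ[ B ∈ Pred (Fin n) 0ℓ ] Σ[ B? ∈ Decidable B ] Σ[ TB? ∈ Decidable (λ e → E e × Touches B e) ]
             (∀ u → B u → V u) × 1 ≤ count B? × q * count TB? ≤ suc q * count B?
    grow {d = d} E? ends zero refl t large =
      contradiction (≤-trans large (*-monoʳ-≤ (q ^ d) (count-≤ (B? t)))) (<⇒≱ q^R*n<[1+q]^R)
    grow {d = d} E? ends (suc fuel) eq t large
      with q * count (boundary? E? ends t) ≤? suc q * count (B? t)
    ... | yes few = inj₂ (B t , B? t , boundary? E? ends t , B⊆V t , ≤-trans (s≤s z≤n) (size t) , few)
    ... | no many with next-layer E? ends t
    ...   | inj₁ (L , L≤ , c) = inj₁ (L , ≤-trans L≤ (s≤s (+-mono-≤ d<R d<R)) , c)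
      where
      d<R : suc d ≤ R
      d<R = subst (suc d ≤_) (trans (+-suc fuel d) eq) (m≤n+m (suc d) fuel)
    ...   | inj₂ (t′ , t′-large) = grow E? ends fuel (trans (+-suc fuel d) eq) t′ (begin
      suc q * suc q ^ d                   ≤⟨ *-monoʳ-≤ (suc q) large ⟩
      suc q * (q ^ d * count (B? t))      ≡⟨ shuffle (suc q) (q ^ d) (count (B? t)) ⟩
      q ^ d * (suc q * count (B? t))      ≤⟨ *-monoʳ-≤ (q ^ d) (<⇒≤ (≰⇒> many)) ⟩
      q ^ d * (q * count (boundary? E? ends t)) ≤⟨ *-monoʳ-≤ (q ^ d) (*-monoʳ-≤ q (≤-trans (n≤1+n _) t′-large)) ⟩
      q ^ d * (q * count (B? t′))         ≡⟨ regroup q (q ^ d) (count (B? t′)) ⟩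
      q * q ^ d * count (B? t′)           ∎)
      where
      open ≤-Reasoning
      shuffle : ∀ a b c → a * (b * c) ≡ b * (a * c)
      shuffle = solve-∀
      regroup : ∀ a b c → b * (a * c) ≡ a * b * c
      regroup = solve-∀

    -- Induction on the bound `s` for the number of vertices. Deleting a ball from `grow` removes at
    -- most 1 + 1/q times as many edges as vertices, so the strict inequality persists. Subgraphs
    -- are predicates on the fixed `H`, hence a cycle found at any stage is one of `H`.
    dense⇒short-cycle : ∀ s {V E} (V? : Decidable V) (E? : Decidable E) →
      (∀ {e u v} → E e → Joins H e u v → V v) → count V? ≤ s →
      suc q * count V? < q * count E? → ShortCycle (suc (R + R))
    dense⇒short-cycle s {V} {E} V? E? ends V≤s dense
      -- The strict inequality forces an edge to exist; one of its ends becomes the root.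
      with count-witness E? (n≢0⇒n>0 (λ E≡0 →
        n≮0 (subst (suc q * count V? <_) (trans (cong (q *_) E≡0) (*-zeroʳ q)) dense)))
    ... | e , ee with s | grow E? ends R (+-identityʳ R) (singleton-tree (end₂ H e) (ends ee (inj₁ (refl , refl))))
                         (subst (1 ≤_) (sym (trans (+-identityʳ _) (count-single (end₂ H e)))) ≤-refl)
    ...   | _ | inj₁ c = c
    ...   | zero | inj₂ _ = contradiction (≤-trans (count-inhabited V? (ends ee (inj₁ (refl , refl)))) V≤s) λ ()
    ...   | suc s | inj₂ (B , B? , TB? , B⊆V , 1≤B , few) =
      dense⇒short-cycle s V′? E′? ends′ (≤-pred (≤-trans (≤-trans (≤-reflexive (+-comm 1 (count V′?))) (+-monoʳ-≤ (count V′?) 1≤B)) (≤-trans split-V V≤s)))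
        (+-cancelʳ-< (suc q * count B?) (suc q * count V′?) (q * count E′?) (begin-strict
          suc q * count V′? + suc q * count B? ≡⟨ *-distribˡ-+ (suc q) (count V′?) (count B?) ⟨
          suc q * (count V′? + count B?)       ≤⟨ *-monoʳ-≤ (suc q) split-V ⟩
          suc q * count V?                     <⟨ dense ⟩
          q * count E?                         ≤⟨ *-monoʳ-≤ q split-E ⟩
          q * (count E′? + count TB?)          ≡⟨ *-distribˡ-+ q (count E′?) (count TB?) ⟩
          q * count E′? + q * count TB?        ≤⟨ +-monoʳ-≤ (q * count E′?) few ⟩
          q * count E′? + suc q * count B?     ∎))
      where
      open ≤-Reasoning
      V′? : Decidable (λ u → V u × ¬ B u)
      V′? u = V? u ×-dec ¬? (B? u)
      B-touches? : Decidable (Touches B)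
      B-touches? e = B? (end₁ H e) ⊎-dec B? (end₂ H e)
      E′? : Decidable (λ e → E e × ¬ Touches B e)
      E′? e = E? e ×-dec ¬? (B-touches? e)
      ends′ : ∀ {e u v} → E e × ¬ Touches B e → Joins H e u v → V v × ¬ B v
      ends′ (ee , ¬b) j@(inj₁ (_ , refl)) = ends ee j , ¬b ∘ inj₂
      ends′ (ee , ¬b) j@(inj₂ (refl , _)) = ends ee j , ¬b ∘ inj₁
      split-V : count V′? + count B? ≤ count V?
      split-V = count-disjoint V? V′? B? (λ { _ (_ , ¬b) b → contradiction b ¬b })
                  (λ { _ (inj₁ (v , _)) → v ; u (inj₂ b) → B⊆V u b })
      split-E : count E? ≤ count E′? + count TB?
      split-E = count-split E? E′? TB? (λ e ee → case B-touches? e of λ where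
        (yes b) → inj₂ (ee , b)
        (no ¬b) → inj₁ (ee , ¬b))

-- The number of layers

-- Bernoulli's inequality 1 + k/q ≤ (1 + 1/q)^k, multiplied by `q ^ suc k`.
bernoulli : ∀ q k → q ^ k * (q + k) ≤ q * suc q ^ k
bernoulli q zero = ≤-reflexive (lemma q)
  where
  lemma : ∀ q → 1 * (q + 0) ≡ q * 1
  lemma = solve-∀
bernoulli q (suc k) = begin
  -- The added term is the product of 1/q and k/q in (1 + 1/q)(1 + k/q), scaled.
  q * q ^ k * (q + suc k)             ≤⟨ m≤m+n _ (q ^ k * k) ⟩
  q * q ^ k * (q + suc k) + q ^ k * k ≡⟨ lemma q k (q ^ k) ⟩
  suc q * (q ^ k * (q + k))           ≤⟨ *-monoʳ-≤ (suc q) (bernoulli q k) ⟩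
  suc q * (q * suc q ^ k)             ≡⟨ shuffle (suc q) q (suc q ^ k) ⟩
  q * (suc q * suc q ^ k)             ∎
  where
  open ≤-Reasoning
  lemma : ∀ q k x → q * x * (q + suc k) + x * k ≡ suc q * (x * (q + k))
  lemma = solve-∀
  shuffle : ∀ a b c → a * (b * c) ≡ b * (a * c)
  shuffle = solve-∀

-- The case `k = q` of `bernoulli`: `q` layers double the ball.
doubling : ∀ q .{{_ : NonZero q}} → 2 * q ^ q ≤ suc q ^ q
doubling q = *-cancelˡ-≤ q (≤-trans (≤-reflexive (lemma q (q ^ q))) (bernoulli q q))
  where
  lemma : ∀ q x → q * (2 * x) ≡ x * (q + q)
  lemma = solve-∀

n<2^[1+log₂n] : ∀ n → n < 2 ^ suc ⌊log₂ n ⌋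
n<2^[1+log₂n] n = ≰⇒> (λ 2^≤n → <-irrefl refl
  (subst (_≤ ⌊log₂ n ⌋) (⌊log₂[2^n]⌋≡n (suc ⌊log₂ n ⌋)) (⌊log₂⌋-mono-≤ 2^≤n)))

^-distribʳ-* : ∀ k a b → (a * b) ^ k ≡ a ^ k * b ^ k
^-distribʳ-* zero    a b = refl
^-distribʳ-* (suc k) a b = trans (cong (a * b *_) (^-distribʳ-* k a b)) (lemma a b (a ^ k) (b ^ k))
  where
  lemma : ∀ a b x y → a * b * (x * y) ≡ a * x * (b * y)
  lemma = solve-∀

-- `suc ⌊log₂ n ⌋` doublings of `q` layers each exceed `n`.
layers-suffice : ∀ q .{{_ : NonZero q}} n → let R = q * suc ⌊log₂ n ⌋ in q ^ R * n < suc q ^ R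
layers-suffice q n = begin-strict
  q ^ (q * l) * n          <⟨ *-monoʳ-< (q ^ (q * l)) {{m^n≢0 q (q * l)}} (n<2^[1+log₂n] n) ⟩
  q ^ (q * l) * 2 ^ l      ≡⟨ cong (_* 2 ^ l) (^-*-assoc q q l) ⟨
  (q ^ q) ^ l * 2 ^ l      ≡⟨ *-comm ((q ^ q) ^ l) (2 ^ l) ⟩
  2 ^ l * (q ^ q) ^ l      ≡⟨ ^-distribʳ-* l 2 (q ^ q) ⟨
  (2 * q ^ q) ^ l          ≤⟨ ^-monoˡ-≤ l (doubling q) ⟩
  (suc q ^ q) ^ l          ≡⟨ ^-*-assoc (suc q) q l ⟩
  suc q ^ (q * l)          ∎
  where
  open ≤-Reasoning
  l = suc ⌊log₂ n ⌋

-- Independent sets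

module _ {n} {Q : Fin n → Fin n → Set} (Q? : ∀ u v → Dec (Q u v)) (Q-refl : ∀ u → Q u u)
         {P : Pred (Fin n) 0ℓ} (P? : Decidable P) where

  -- Of two chosen vertices, only the direction of `Q` from the earlier choice to the later one is
  -- tested, hence the disjunction in `independent`. `dominates` is maximality, in a form suited to
  -- counting.
  record MaximalIndependent (vs : List (Fin n)) : Set₁ where
    field
      D           : Pred (Fin n) 0ℓ
      D?          : Decidable D
      D⊆P         : ∀ u → D u → P u
      independent : ∀ u v → D u → D v → u ≡ v ⊎ ¬ Q u v ⊎ ¬ Q v u
      dominates   : All (λ v → P v → ∃[ u ] (D u × Q u v)) vs

  greedy : ∀ vs → MaximalIndependent vs
  greedy [] = record
    { D = λ _ → ⊥ ; D? = λ _ → no λ () ; D⊆P = λ _ () ; independent = λ _ _ () ; dominates = [] }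
  greedy (v ∷ vs) = choose (any? (λ u → D? u ×-dec Q? u v)) (P? v)
    where
    open MaximalIndependent (greedy vs)
    keep : (P v → ∃[ u ] (D u × Q u v)) → MaximalIndependent (v ∷ vs)
    keep h = record
      { D = D ; D? = D? ; D⊆P = D⊆P ; independent = independent ; dominates = h ∷ dominates }
    widen : ∀ {w} → ∃[ u ] (D u × Q u w) → ∃[ u ] ((D u ⊎ u ≡ v) × Q u w)
    widen (u , d , q) = u , inj₁ d , q
    choose : Dec (∃[ u ] (D u × Q u v)) → Dec (P v) → MaximalIndependent (v ∷ vs)
    choose (yes dom) _       = keep (λ _ → dom)
    choose (no _)    (no ¬p) = keep (λ p → contradiction p ¬p)
    choose (no ¬dom) (yes p) = record
      { D           = λ u → D u ⊎ u ≡ v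
      ; D?          = λ u → D? u ⊎-dec (u ≟ v)
      ; D⊆P         = λ { u (inj₁ d) → D⊆P u d ; u (inj₂ refl) → p }
      ; independent = λ where
          u w (inj₁ d)    (inj₁ d′)   → independent u w d d′
          u w (inj₁ d)    (inj₂ refl) → inj₂ (inj₁ λ q → ¬dom (u , d , q))
          u w (inj₂ refl) (inj₁ d)    → inj₂ (inj₂ λ q → ¬dom (w , d , q))
          u w (inj₂ refl) (inj₂ refl) → inj₁ refl
      ; dominates   = (λ _ → v , inj₂ refl , Q-refl v) ∷
                      All.map (λ h p′ → widen (h p′)) dominates
      }

  module _ (s : ℕ) (bounded : ∀ u → P u → count (Q? u) ≤ s) where

    open MaximalIndependent (greedy (allFin n))

    -- Double counting of pairs: each vertex of `P` is dominated by a member of `D`, and each member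
    -- dominates at most `s` vertices.
    greedy-large : count P? ≤ count D? * s
    greedy-large = begin
      sum (λ v → 𝟙 (P? v))                                 ≤⟨ sum-mono (λ v → 𝟙-elim (P? v) (hit v)) ⟩
      sum (λ v → sum (λ u → 𝟙 (D? u) * 𝟙 (Q? u v)))       ≡⟨ ∑-comm (λ v u → 𝟙 (D? u) * 𝟙 (Q? u v)) ⟩
      sum (λ u → sum (λ v → 𝟙 (D? u) * 𝟙 (Q? u v)))       ≡⟨ sum-cong-≗ (λ u → *-distribˡ-sum (𝟙 (D? u)) (λ v → 𝟙 (Q? u v))) ⟨
      sum (λ u → 𝟙 (D? u) * count (Q? u))                  ≤⟨ sum-mono per-vertex ⟩
      sum (λ u → 𝟙 (D? u) * s)                             ≡⟨ *-distribʳ-sum s (λ u → 𝟙 (D? u)) ⟨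
      count D? * s                                          ∎
      where
      open ≤-Reasoning
      hit : ∀ v → P v → 1 ≤ sum (λ u → 𝟙 (D? u) * 𝟙 (Q? u v))
      hit v p with lookup dominates (∈-allFin v) p
      ... | u , d , q = ≤-trans (*-mono-≤ (𝟙-intro (D? u) d) (𝟙-intro (Q? u v) q))
                                (term≤sum (λ u → 𝟙 (D? u) * 𝟙 (Q? u v)) u)
      per-vertex : ∀ u → 𝟙 (D? u) * count (Q? u) ≤ 𝟙 (D? u) * s
      per-vertex u with D? u
      ... | yes d = *-monoʳ-≤ 1 (bounded u (D⊆P u d))
      ... | no _  = z≤n

-- Deleting vertices

module _ {n} (G : Graph n) where

  incident? : ∀ v e → Dec (Incident G v e)
  incident? v e = (end₁ G e ≟ v) ⊎-dec (end₂ G e ≟ v)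

  ends≤2 : ∀ e → count (λ v → incident? v e) ≤ 2
  ends≤2 e = ≤-trans
    (count-split (λ v → incident? v e) (_≟ end₁ G e) (_≟ end₂ G e) (λ v → map-⊎ sym sym))
    (≤-reflexive (cong₂ _+_ (count-single (end₁ G e)) (count-single (end₂ G e))))

  two-common-ends : ∀ {e f u v} → u ≢ v → Incident G u e → Incident G v e →
                    Incident G u f → Incident G v f → e ≡ f
  two-common-ends {e} {f} {u} {v} u≢v ue ve uf vf = Joins-unique G (joined ue ve) (joined uf vf)
    where
    joined : ∀ {e} → Incident G u e → Incident G v e → Joins G e u v
    joined (inj₁ p) (inj₁ q) = contradiction (trans (sym p) q) u≢v
    joined (inj₁ p) (inj₂ q) = inj₁ (p , q)
    joined (inj₂ p) (inj₁ q) = inj₂ (q , p)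
    joined (inj₂ p) (inj₂ q) = contradiction (trans (sym p) q) u≢v

  -- Two common ends would make the edges parallel, hence equal.
  common-end≤1 : ∀ {e f} → e ≢ f → count (λ v → incident? v e ×-dec incident? v f) ≤ 1
  common-end≤1 {e} {f} e≢f with any? (λ v → incident? v e ×-dec incident? v f)
  ... | no ¬v = ≤-trans (≤-reflexive (count-none (λ v → incident? v e ×-dec incident? v f) (λ v b → ¬v (v , b)))) z≤n
  ... | yes (v , ve , vf) = ≤-trans (count-mono (λ v → incident? v e ×-dec incident? v f) (_≟ v) unique)
                                    (≤-reflexive (count-single v))
    where
    unique : ∀ u → Incident G u e × Incident G u f → u ≡ v
    unique u (ue , uf) with u ≟ v
    ... | yes eq = eq
    ... | no u≢v = contradiction (two-common-ends u≢v ue ve uf vf) e≢f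

-- Colour i is represented by two of its edges, possibly equal. A set of vertices that meets both of
-- them contains a common end of the two or a conflicting pair.
module Deletion {n} (G : Graph n) (e₁ e₂ : Fin n → Fin (m G)) where

  both? : ∀ v → Decidable (λ i → Incident G v (e₁ i) × Incident G v (e₂ i))
  both? v i = incident? G v (e₁ i) ×-dec incident? G v (e₂ i)

  weight degree : Fin n → ℕ
  weight v = count (both? v)
  degree v = sum (λ i → 𝟙 (incident? G v (e₁ i)) + 𝟙 (incident? G v (e₂ i)))

  -- Handshaking: each colour contributes two edges with two ends each.
  total-degree : sum degree ≤ n * 4
  total-degree = begin
    sum degree
      ≡⟨ ∑-comm (λ v i → 𝟙 (incident? G v (e₁ i)) + 𝟙 (incident? G v (e₂ i))) ⟩
    sum (λ i → sum (λ v → 𝟙 (incident? G v (e₁ i)) + 𝟙 (incident? G v (e₂ i))))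
      ≡⟨ sum-cong-≗ (λ i → ∑-distrib-+ (λ v → 𝟙 (incident? G v (e₁ i))) (λ v → 𝟙 (incident? G v (e₂ i)))) ⟩
    sum (λ i → count (λ v → incident? G v (e₁ i)) + count (λ v → incident? G v (e₂ i)))
      ≤⟨ sum-mono (λ i → +-mono-≤ (ends≤2 G (e₁ i)) (ends≤2 G (e₂ i))) ⟩
    sum {n} (λ _ → 4)
      ≡⟨ sum-const n 4 ⟩
    n * 4 ∎
    where open ≤-Reasoning

  Conflict : Fin n → Fin n → Set
  Conflict u v = ∃[ i ] (Incident G u (e₁ i) × Incident G v (e₂ i))

  conflict? : ∀ u v → Dec (Conflict u v)
  conflict? u v = any? (λ i → incident? G u (e₁ i) ×-dec incident? G v (e₂ i))

  -- Symmetric, so that excluding one order of a pair excludes conflicts in both; reflexive, as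
  -- `greedy` demands.
  Near : Fin n → Fin n → Set
  Near u v = v ≡ u ⊎ Conflict u v ⊎ Conflict v u

  near? : ∀ u v → Dec (Near u v)
  near? u v = (v ≟ u) ⊎-dec (conflict? u v ⊎-dec conflict? v u)

  -- Each vertex counted is one of the two ends of `g i` for some colour `i` with `f i` at `u`. Both
  -- orders of `e₁` and `e₂` are used below.
  conflicts-bound : ∀ (f g : Fin n → Fin (m G)) u {P : Pred (Fin n) 0ℓ} (P? : Decidable P) →
    (∀ v → P v → ∃[ i ] (Incident G u (f i) × Incident G v (g i))) →
    count P? ≤ sum (λ i → 𝟙 (incident? G u (f i)) * 2)
  conflicts-bound f g u P? h = begin
    count P?
      ≤⟨ sum-mono (λ v → 𝟙-elim (P? v) (hit v)) ⟩
    sum (λ v → sum (λ i → 𝟙 (incident? G u (f i)) * 𝟙 (incident? G v (g i))))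
      ≡⟨ ∑-comm (λ v i → 𝟙 (incident? G u (f i)) * 𝟙 (incident? G v (g i))) ⟩
    sum (λ i → sum (λ v → 𝟙 (incident? G u (f i)) * 𝟙 (incident? G v (g i))))
      ≡⟨ sum-cong-≗ (λ i → *-distribˡ-sum (𝟙 (incident? G u (f i))) (λ v → 𝟙 (incident? G v (g i)))) ⟨
    sum (λ i → 𝟙 (incident? G u (f i)) * count (λ v → incident? G v (g i)))
      ≤⟨ sum-mono (λ i → *-monoʳ-≤ (𝟙 (incident? G u (f i))) (ends≤2 G (g i))) ⟩
    sum (λ i → 𝟙 (incident? G u (f i)) * 2) ∎
    where
    open ≤-Reasoning
    hit : ∀ v → _ → 1 ≤ sum (λ i → 𝟙 (incident? G u (f i)) * 𝟙 (incident? G v (g i)))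
    hit v p with h v p
    ... | i , a , b = ≤-trans (*-mono-≤ (𝟙-intro (incident? G u (f i)) a) (𝟙-intro (incident? G v (g i)) b))
                              (term≤sum (λ i → 𝟙 (incident? G u (f i)) * 𝟙 (incident? G v (g i))) i)

  near-bound : ∀ u → count (near? u) ≤ suc (degree u * 2)
  near-bound u = begin
    count (near? u)
      ≤⟨ count-split (near? u) (_≟ u) (λ v → conflict? u v ⊎-dec conflict? v u) (λ _ → id) ⟩
    count (_≟ u) + count (λ v → conflict? u v ⊎-dec conflict? v u)
      ≤⟨ +-mono-≤ (≤-reflexive (count-single u))
           (count-split (λ v → conflict? u v ⊎-dec conflict? v u) (conflict? u) (λ v → conflict? v u) (λ _ → id)) ⟩
    suc (count (conflict? u) + count (λ v → conflict? v u))
      ≤⟨ s≤s (+-mono-≤ (conflicts-bound e₁ e₂ u (conflict? u) (λ _ → id))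
                       (conflicts-bound e₂ e₁ u (λ v → conflict? v u) (λ { _ (i , a , b) → i , b , a }))) ⟩
    suc (sum (λ i → 𝟙 (incident? G u (e₁ i)) * 2) + sum (λ i → 𝟙 (incident? G u (e₂ i)) * 2))
      ≡⟨ cong suc (cong₂ _+_ (*-distribʳ-sum 2 (λ i → 𝟙 (incident? G u (e₁ i)))) (*-distribʳ-sum 2 (λ i → 𝟙 (incident? G u (e₂ i))))) ⟨
    suc (sum (λ i → 𝟙 (incident? G u (e₁ i))) * 2 + sum (λ i → 𝟙 (incident? G u (e₂ i))) * 2)
      ≡⟨ cong suc (*-distribʳ-+ 2 (sum (λ i → 𝟙 (incident? G u (e₁ i)))) (sum (λ i → 𝟙 (incident? G u (e₂ i))))) ⟨
    suc ((sum (λ i → 𝟙 (incident? G u (e₁ i))) + sum (λ i → 𝟙 (incident? G u (e₂ i)))) * 2)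
      ≡⟨ cong (λ k → suc (k * 2)) (∑-distrib-+ (λ i → 𝟙 (incident? G u (e₁ i))) (λ i → 𝟙 (incident? G u (e₂ i)))) ⟨
    suc (degree u * 2) ∎
    where open ≤-Reasoning

  module Greedy (shared : Fin n → ℕ) (shared-bound : ∀ i → count (λ v → both? v i) ≤ shared i) (k : ℕ) where

    -- Weight 0 and degree below `k` in a single inequality, whose failure can be summed over the
    -- vertices.
    Good : Pred (Fin n) 0ℓ
    Good v = k * weight v + degree v < k

    good? : Decidable Good
    good? v = _ <? k

    good-weight : ∀ v → Good v → weight v ≡ 0
    good-weight v g = n<1⇒n≡0 (*-cancelˡ-< k (weight v) 1
      (subst (k * weight v <_) (sym (*-identityʳ k)) (≤-<-trans (m≤m+n _ (degree v)) g)))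

    -- Markov's inequality for `k * weight v + degree v`; the total weight is counted colour by
    -- colour.
    few-bad : k * count (λ v → ¬? (good? v)) ≤ k * sum shared + n * 4
    few-bad = begin
      k * count (λ v → ¬? (good? v))
        ≡⟨ *-distribˡ-sum k (λ v → 𝟙 (¬? (good? v))) ⟩
      sum (λ v → k * 𝟙 (¬? (good? v)))
        ≤⟨ sum-mono charge ⟩
      sum (λ v → k * weight v + degree v)
        ≡⟨ ∑-distrib-+ (λ v → k * weight v) degree ⟩
      sum (λ v → k * weight v) + sum degree
        ≡⟨ cong (_+ sum degree) (*-distribˡ-sum k weight) ⟨
      k * sum weight + sum degree
        ≡⟨ cong (λ x → k * x + sum degree) (∑-comm (λ v i → 𝟙 (both? v i))) ⟩
      k * sum (λ i → count (λ v → both? v i)) + sum degree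
        ≤⟨ +-mono-≤ (*-monoʳ-≤ k (sum-mono shared-bound)) total-degree ⟩
      k * sum shared + n * 4 ∎
      where
      open ≤-Reasoning
      charge : ∀ v → k * 𝟙 (¬? (good? v)) ≤ k * weight v + degree v
      charge v with good? v
      ... | yes _ = ≤-trans (≤-reflexive (*-zeroʳ k)) z≤n
      ... | no ¬g = ≤-trans (≤-reflexive (*-identityʳ k)) (≮⇒≥ ¬g)

    open MaximalIndependent (greedy near? (λ _ → inj₁ refl) good? (allFin n)) public

    good≤deleted : count good? ≤ count D? * suc (k * 2)
    good≤deleted = greedy-large near? (λ _ → inj₁ refl) good? (suc (k * 2))
      (λ u g → ≤-trans (near-bound u) (s≤s (*-monoˡ-≤ 2 (≤-trans (m≤n+m (degree u) (k * weight u)) (<⇒≤ g)))))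

    Avoids : Fin (m G) → Set
    Avoids e = ¬ D (end₁ G e) × ¬ D (end₂ G e)

    avoids-or-meets : ∀ e → Avoids e ⊎ ∃[ u ] (D u × Incident G u e)
    avoids-or-meets e with D? (end₁ G e) | D? (end₂ G e)
    ... | yes d | _     = inj₂ (end₁ G e , d , inj₁ refl)
    ... | no _  | yes d = inj₂ (end₂ G e , d , inj₂ refl)
    ... | no a  | no b  = inj₁ (a , b)

    -- For `u ≡ v` the conflict would be a common end, against weight 0; otherwise independence
    -- excludes it.
    no-conflict : ∀ {u v} → D u → D v → ¬ Conflict u v
    no-conflict {u} {v} du dv (i , a , b) with independent u v du dv
    ... | inj₁ refl      = contradiction (count-inhabited (both? u) (a , b))
                             (λ 1≤w → n≮0 (subst (1 ≤_) (good-weight u (D⊆P u du)) 1≤w))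
    ... | inj₂ (inj₁ ¬q) = ¬q (inj₂ (inj₁ (i , a , b)))
    ... | inj₂ (inj₂ ¬q) = ¬q (inj₂ (inj₂ (i , a , b)))

    survivor : ∀ i → ∃[ e ] ((e ≡ e₁ i ⊎ e ≡ e₂ i) × Avoids e)
    survivor i with avoids-or-meets (e₁ i) | avoids-or-meets (e₂ i)
    ... | inj₁ a | _      = e₁ i , inj₁ refl , a
    ... | inj₂ _ | inj₁ a = e₂ i , inj₂ refl , a
    ... | inj₂ (u , du , ue) | inj₂ (v , dv , ve) = contradiction (i , ue , ve) (no-conflict du dv)

-- Transversals of the colour classes

module _ {n} (G : Graph n) (c : Coloring G n) (rep : Fin n → Fin (m G)) (c-rep : ∀ i → c (rep i) ≡ i) where

  -- The colours themselves serve as edges, so distinct edges have distinct colours in `G`. The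
  -- graph stays simple because `c` inverts `rep`.
  transversal : Graph n
  transversal = record
    { m        = n
    ; end₁     = end₁ G ∘ rep
    ; end₂     = end₂ G ∘ rep
    ; loopless = loopless G ∘ rep
    ; simple   = λ i j p → trans (sym (c-rep i)) (trans (cong c (simple G (rep i) (rep j) p)) (c-rep j))
    }

  transversal-cycle : ∀ {L} → RainbowCycle transversal id L → RainbowCycle G c L
  transversal-cycle C = record
    { j = j ; len = len ; long = long ; vs = vs ; vs-inj = vs-inj
    ; es      = rep ∘ es
    ; joins   = joins
    ; rainbow = λ eq → rainbow (trans (sym (c-rep _)) (trans eq (c-rep _)))
    }
    where open RainbowCycle C

-- The theorem with integral hypotheses

∣∣≡count : ∀ {n} (S : Subset n) → ∣ S ∣ ≡ count (_∈? S)
∣∣≡count [] = refl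
∣∣≡count (inside ∷ S) = cong suc (trans (∣∣≡count S) (sum-cong-≗ lemma))
  where
  lemma : ∀ i → 𝟙 (i ∈? S) ≡ 𝟙 (suc i ∈? (inside ∷ S))
  lemma i with i ∈? S
  ... | yes _ = refl
  ... | no _  = refl
∣∣≡count (outside ∷ S) = trans (∣∣≡count S) (sum-cong-≗ lemma)
  where
  lemma : ∀ i → 𝟙 (i ∈? S) ≡ 𝟙 (suc i ∈? (outside ∷ S))
  lemma i with i ∈? S
  ... | yes _ = refl
  ... | no _  = refl

-- A surplus of n / d in 2 |FM| + |FS| has to pay for the total degree 4 n, with n left over.
threshold density : ℕ → ℕ
threshold d = 5 * d
density d = threshold d * suc (threshold d * 2)

instance
  density-nonZero : ∀ {d} .{{_ : NonZero d}} → NonZero (density d)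
  density-nonZero {d} = m*n≢0 (5 * d) (suc (5 * d * 2)) {{m*n≢0 5 d}}

-- `excess` is 0 for a matching, 1 for a star and 2 otherwise: the possible number of common ends of
-- two edges that are disjoint, distinct or perhaps equal. `budget` is additive so that summing over
-- the colours needs no truncated subtraction.
record Representatives {n} (G : Graph n) (c : Coloring G n) (FM FS : Subset n) (i : Fin n) : Set where
  field
    e f    : Fin (m G)
    c-e    : c e ≡ i
    c-f    : c f ≡ i
    excess : ℕ
    budget : excess + (2 * 𝟙 (i ∈? FM) + 𝟙 (i ∈? FS)) ≡ 2
    shared : count (λ v → incident? G v e ×-dec incident? G v f) ≤ excess

module _ {n} (G : Graph n) (c : Coloring G n) (FM FS : Subset n)
  (nonempty : ∀ i → ∃[ e ] (c e ≡ i))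
  (matchings : ∀ i → i ∈ FM → HasMatching2 G c i)
  (disjoint : ∀ i → i ∈ FS → i ∉ FM)
  (stars : ∀ i → i ∈ FS → HasStar2 G c i) where

  representatives : ∀ i → Representatives G c FM FS i
  representatives i with i ∈? FM in eqM | i ∈? FS in eqS
  ... | yes M | yes S = contradiction M (disjoint i S)
  ... | yes M | no _ with e , f , ce , cf , ≢₁₁ , ≢₁₂ , ≢₂₁ , ≢₂₂ ← matchings i M = record
    { e = e ; f = f ; c-e = ce ; c-f = cf ; excess = 0
    ; budget = cong₂ (λ x y → 2 * 𝟙 x + 𝟙 y) eqM eqS
    ; shared = ≤-reflexive (count-none (λ v → incident? G v e ×-dec incident? G v f) λ where
        v (inj₁ p , inj₁ q) → ≢₁₁ (trans p (sym q))
        v (inj₁ p , inj₂ q) → ≢₁₂ (trans p (sym q))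
        v (inj₂ p , inj₁ q) → ≢₂₁ (trans p (sym q))
        v (inj₂ p , inj₂ q) → ≢₂₂ (trans p (sym q)))
    }
  ... | no _ | yes S with e , f , ce , cf , e≢f , _ ← stars i S = record
    { e = e ; f = f ; c-e = ce ; c-f = cf ; excess = 1
    ; budget = cong₂ (λ x y → 1 + (2 * 𝟙 x + 𝟙 y)) eqM eqS
    ; shared = common-end≤1 G e≢f
    }
  ... | no _ | no _ with e , ce ← nonempty i = record
    { e = e ; f = e ; c-e = ce ; c-f = ce ; excess = 2
    ; budget = cong₂ (λ x y → 2 + (2 * 𝟙 x + 𝟙 y)) eqM eqS
    ; shared = ≤-trans (count-mono (λ v → incident? G v e ×-dec incident? G v e) (λ v → incident? G v e) (λ _ → proj₁))
                       (ends≤2 G e)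
    }

  private module Rep i = Representatives (representatives i)

  total-excess : sum Rep.excess + (2 * ∣ FM ∣ + ∣ FS ∣) ≡ n * 2
  total-excess = begin
    sum Rep.excess + (2 * ∣ FM ∣ + ∣ FS ∣)
      ≡⟨ cong₂ (λ x y → sum Rep.excess + (2 * x + y)) (∣∣≡count FM) (∣∣≡count FS) ⟩
    sum Rep.excess + (2 * count (_∈? FM) + count (_∈? FS))
      ≡⟨ cong (λ x → sum Rep.excess + (x + count (_∈? FS))) (*-distribˡ-sum 2 (λ i → 𝟙 (i ∈? FM))) ⟩
    sum Rep.excess + (sum (λ i → 2 * 𝟙 (i ∈? FM)) + count (_∈? FS))
      ≡⟨ cong (sum Rep.excess +_) (∑-distrib-+ (λ i → 2 * 𝟙 (i ∈? FM)) (λ i → 𝟙 (i ∈? FS))) ⟨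
    sum Rep.excess + sum (λ i → 2 * 𝟙 (i ∈? FM) + 𝟙 (i ∈? FS))
      ≡⟨ ∑-distrib-+ Rep.excess (λ i → 2 * 𝟙 (i ∈? FM) + 𝟙 (i ∈? FS)) ⟨
    sum (λ i → Rep.excess i + (2 * 𝟙 (i ∈? FM) + 𝟙 (i ∈? FS)))
      ≡⟨ sum-cong-≗ Rep.budget ⟩
    sum {n} (λ _ → 2)
      ≡⟨ sum-const n 2 ⟩
    n * 2 ∎
    where open ≡-Reasoning

  module _ (d : ℕ) .{{_ : NonZero d}} (n≥1 : 1 ≤ n) (surplus : suc d * n ≤ d * (2 * ∣ FM ∣ + ∣ FS ∣)) where

    private
      k q : ℕ
      k = threshold d
      q = density d

    open Deletion G Rep.e Rep.f
    open Greedy Rep.excess Rep.shared k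

    good : ℕ
    good = count good?

    bad : ℕ
    bad = count (λ v → ¬? (good? v))

    W : ℕ
    W = sum Rep.excess

    -- The surplus subtracted from `total-excess`: at most (1 - 1/d) n common ends in total.
    excess-small : d * W + n ≤ d * n
    excess-small = +-cancelʳ-≤ (d * n) _ _ (begin
      d * W + n + d * n                         ≡⟨ +-assoc (d * W) n (d * n) ⟩
      d * W + suc d * n                         ≤⟨ +-monoʳ-≤ (d * W) surplus ⟩
      d * W + d * (2 * ∣ FM ∣ + ∣ FS ∣)         ≡⟨ *-distribˡ-+ d W (2 * ∣ FM ∣ + ∣ FS ∣) ⟨
      d * (W + (2 * ∣ FM ∣ + ∣ FS ∣))           ≡⟨ cong (d *_) total-excess ⟩
      d * (n * 2)                               ≡⟨ lemma d n ⟩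
      d * n + d * n                             ∎)
      where
      open ≤-Reasoning
      lemma : ∀ d n → d * (n * 2) ≡ d * n + d * n
      lemma = solve-∀

    -- Five times `excess-small` gains 5 n, of which `few-bad` consumes 4 n.
    many-good : n ≤ k * good
    many-good = +-cancelʳ-≤ (k * W + n * 4) _ _ (begin
      n + (k * W + n * 4)  ≡⟨ lemma d W n ⟩
      5 * (d * W + n)      ≤⟨ *-monoʳ-≤ 5 excess-small ⟩
      5 * (d * n)          ≡⟨ *-assoc 5 d n ⟨
      k * n                ≡⟨ cong (k *_) (count-¬ good?) ⟨
      k * (good + bad)     ≡⟨ *-distribˡ-+ k good bad ⟩
      k * good + k * bad   ≤⟨ +-monoʳ-≤ (k * good) few-bad ⟩
      k * good + (k * W + n * 4) ∎)
      where
      open ≤-Reasoning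
      lemma : ∀ d w n → n + (5 * d * w + n * 4) ≡ 5 * (d * w + n)
      lemma = solve-∀

    many-deleted : n ≤ q * count D?
    many-deleted = begin
      n                                    ≤⟨ many-good ⟩
      k * good                             ≤⟨ *-monoʳ-≤ k good≤deleted ⟩
      k * (count D? * suc (k * 2))   ≡⟨ lemma k (count D?) (suc (k * 2)) ⟩
      q * count D?                   ∎
      where
      open ≤-Reasoning
      lemma : ∀ a b c → a * (b * c) ≡ a * c * b
      lemma = solve-∀

    -- At least n/q vertices are deleted, which pays for the extra `kept`; strictness comes from `D`
    -- being non-empty, as `n ≥ 1`.
    dense : suc q * count (λ v → ¬? (D? v)) < q * n
    dense = begin-strict
      suc q * kept             ≡⟨⟩
      kept + q * kept          <⟨ +-monoˡ-< (q * kept) kept<n ⟩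
      n + q * kept             ≤⟨ +-monoˡ-≤ (q * kept) many-deleted ⟩
      q * count D? + q * kept ≡⟨ *-distribˡ-+ q (count D?) kept ⟨
      q * (count D? + kept)   ≡⟨ cong (q *_) (count-¬ D?) ⟩
      q * n                    ∎
      where
      open ≤-Reasoning
      kept = count (λ v → ¬? (D? v))
      deleted≥1 : 1 ≤ count D?
      deleted≥1 = n≢0⇒n>0 (λ 0≡ → n≮0 (≤-trans n≥1 (subst (n ≤_) (trans (cong (q *_) 0≡) (*-zeroʳ q)) many-deleted)))
      kept<n : kept < n
      kept<n = subst (kept <_) (count-¬ D?) (+-monoˡ-≤ kept deleted≥1)

    rep : Fin n → Fin (m G)
    rep i = proj₁ (survivor i)

    c-rep : ∀ i → c (rep i) ≡ i
    c-rep i with survivor i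
    ... | _ , inj₁ refl , _ = Rep.c-e i
    ... | _ , inj₂ refl , _ = Rep.c-f i

    avoids : ∀ i → Avoids (rep i)
    avoids i = proj₂ (proj₂ (survivor i))

    H : Graph n
    H = transversal G c rep c-rep

    H-ends : ∀ {i u v} → ⊤ → Joins H i u v → ¬ D v
    H-ends {i} _ (inj₁ (_ , refl)) = proj₂ (avoids i)
    H-ends {i} _ (inj₂ (refl , _)) = proj₁ (avoids i)

    short-rainbow-cycle : let R = q * suc ⌊log₂ n ⌋ in ∃[ L ] (L ≤ suc (R + R) × RainbowCycle G c L)
    -- `q` measures both the density of the subgraph and the growth of its balls. All `n` edges of
    -- `H` survive, since they avoid `D`.
    short-rainbow-cycle = map₂ (map₂ (transversal-cycle G c rep c-rep))
      (dense⇒short-cycle H q (q * suc ⌊log₂ n ⌋) (layers-suffice q n) n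
        (λ v → ¬? (D? v)) (λ _ → yes tt) H-ends (count-≤ (λ v → ¬? (D? v)))
        (<-≤-trans dense (*-monoʳ-≤ q (count-all {P = λ _ → ⊤} (λ _ → yes tt) (λ _ → tt)))))

-- From rationals to integers

toℚᵘ-ℕ→ℚ : ∀ k → ℚ.toℚᵘ (ℕ→ℚ k) ℚᵘ.≃ ℚᵘ.mkℚᵘ (ℤ.+ k) 0
toℚᵘ-ℕ→ℚ k = ℚₚ.toℚᵘ-fromℚᵘ (ℚᵘ.mkℚᵘ (ℤ.+ k) 0)

-- Computed in unnormalised fractions, where equality is cross multiplication and no common factors
-- are cancelled.
cross-multiply : ∀ a d-1 .(cop : Coprime a (suc d-1)) n M S → let s = ℚ.mkℚ (ℤ.+ a) d-1 cop in
  ℕ→ℚ 2 *ℚ ℕ→ℚ M +ℚ ℕ→ℚ S ≡ s *ℚ ℕ→ℚ n → suc d-1 * (2 * M + S) ≡ a * n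
cross-multiply a d-1 cop n M S eq = ℤₚ.+-injective (trans left (trans (ℚᵘₚ.drop-*≡* u) right))
  where
  s = ℚ.mkℚ (ℤ.+ a) d-1 cop
  u : ℚᵘ.mkℚᵘ (ℤ.+ 2) 0 ℚᵘ.* ℚᵘ.mkℚᵘ (ℤ.+ M) 0 ℚᵘ.+ ℚᵘ.mkℚᵘ (ℤ.+ S) 0 ℚᵘ.≃ ℚ.toℚᵘ s ℚᵘ.* ℚᵘ.mkℚᵘ (ℤ.+ n) 0
  u = begin
    ℚᵘ.mkℚᵘ (ℤ.+ 2) 0 ℚᵘ.* ℚᵘ.mkℚᵘ (ℤ.+ M) 0 ℚᵘ.+ ℚᵘ.mkℚᵘ (ℤ.+ S) 0
      ≈⟨ ℚᵘₚ.+-cong (ℚᵘₚ.*-cong (toℚᵘ-ℕ→ℚ 2) (toℚᵘ-ℕ→ℚ M)) (toℚᵘ-ℕ→ℚ S) ⟨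
    ℚ.toℚᵘ (ℕ→ℚ 2) ℚᵘ.* ℚ.toℚᵘ (ℕ→ℚ M) ℚᵘ.+ ℚ.toℚᵘ (ℕ→ℚ S)
      ≈⟨ ℚᵘₚ.+-congˡ _ (ℚₚ.toℚᵘ-homo-* (ℕ→ℚ 2) (ℕ→ℚ M)) ⟨
    ℚ.toℚᵘ (ℕ→ℚ 2 *ℚ ℕ→ℚ M) ℚᵘ.+ ℚ.toℚᵘ (ℕ→ℚ S)
      ≈⟨ ℚₚ.toℚᵘ-homo-+ (ℕ→ℚ 2 *ℚ ℕ→ℚ M) (ℕ→ℚ S) ⟨
    ℚ.toℚᵘ (ℕ→ℚ 2 *ℚ ℕ→ℚ M +ℚ ℕ→ℚ S)
      ≡⟨ cong ℚ.toℚᵘ eq ⟩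
    ℚ.toℚᵘ (s *ℚ ℕ→ℚ n)
      ≈⟨ ℚₚ.toℚᵘ-homo-* s (ℕ→ℚ n) ⟩
    ℚ.toℚᵘ s ℚᵘ.* ℚ.toℚᵘ (ℕ→ℚ n)
      ≈⟨ ℚᵘₚ.*-congˡ {ℚ.toℚᵘ s} (toℚᵘ-ℕ→ℚ n) ⟩
    ℚ.toℚᵘ s ℚᵘ.* ℚᵘ.mkℚᵘ (ℤ.+ n) 0 ∎
    where open import Relation.Binary.Reasoning.Setoid ℚᵘₚ.≃-setoid
  lemma : ∀ d m s → d * (2 * m + s) ≡ (2 * m * 1 + s * 1) * (d * 1)
  lemma = solve-∀
  left : ℤ.+ (suc d-1 * (2 * M + S)) ≡
         ((ℤ.+ 2 ℤ.* ℤ.+ M) ℤ.* ℤ.+ 1 ℤ.+ ℤ.+ S ℤ.* ℤ.+ 1) ℤ.* ℤ.+ (suc d-1 * 1)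
  left = trans (cong ℤ.+_ (lemma (suc d-1) M S)) (trans (ℤₚ.pos-* (2 * M * 1 + S * 1) (suc d-1 * 1))
    (cong (ℤ._* ℤ.+ (suc d-1 * 1)) (cong₂ ℤ._+_
      (trans (ℤₚ.pos-* (2 * M) 1) (cong (ℤ._* ℤ.+ 1) (ℤₚ.pos-* 2 M))) (ℤₚ.pos-* S 1))))
  right : (ℤ.+ a ℤ.* ℤ.+ n) ℤ.* ℤ.+ 1 ≡ ℤ.+ (a * n)
  right = trans (ℤₚ.*-identityʳ (ℤ.+ a ℤ.* ℤ.+ n)) (sym (ℤₚ.pos-* a n))

-- `d` is the denominator of `s`: a fraction a/d above 1 has a ≥ d + 1, so it exceeds 1 by at least
-- 1/d.
clear-denominator : ∀ s → 1ℚ <ℚ s → ∃[ d ] (NonZero d × (∀ n M S →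
  ℕ→ℚ 2 *ℚ ℕ→ℚ M +ℚ ℕ→ℚ S ≡ s *ℚ ℕ→ℚ n → suc d * n ≤ d * (2 * M + S)))
clear-denominator s@(ℚ.mkℚ (ℤ.+ a) d-1 cop) 1<s = suc d-1 , _ , λ n M S eq →
  ≤-trans (*-monoˡ-≤ n d<a) (≤-reflexive (sym (cross-multiply a d-1 cop n M S eq)))
  where
  d<a : suc d-1 < a
  d<a = ℤₚ.drop‿+<+ (subst₂ ℤ._<_ (ℤₚ.*-identityˡ (ℤ.+ suc d-1)) (ℤₚ.*-identityʳ (ℤ.+ a)) (ℚₚ.drop-*<* 1<s))
clear-denominator (ℚ.mkℚ ℤ.-[1+ a ] d-1 _) 1<s = contradiction (ℚₚ.drop-*<* 1<s) λ ()

combine : ∀ α β {M S n : ℚ} → M ≡ α *ℚ n → S ≡ β *ℚ n → ℕ→ℚ 2 *ℚ M +ℚ S ≡ (ℕ→ℚ 2 *ℚ α +ℚ β) *ℚ n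
combine α β {n = n} refl refl =
  trans (cong (_+ℚ β *ℚ n) (sym (ℚₚ.*-assoc (ℕ→ℚ 2) α n))) (sym (ℚₚ.*-distribʳ-+ n (ℕ→ℚ 2 *ℚ α) β))

-- For `n = 1` the logarithm is 0 and bounds no cycle; this case is void, because the single colour
-- class would need an edge.
one-vertex-edgeless : (G : Graph 1) → ¬ Fin (m G)
one-vertex-edgeless G e with end₁ G e | end₂ G e | loopless G e
... | zero | zero | ≢ = ≢ refl

-- The additive 2 q + 1 is at most (2 q + 1) l, which gives the factor 4 q + 1. The bound on `l`
-- holds for `n ≥ 2`.
absorb-constant : ∀ q l → 1 ≤ l → suc (q * suc l + q * suc l) ≤ suc (4 * q) * l
absorb-constant q l 1≤l = begin
  suc (q * suc l + q * suc l)         ≡⟨ expand q l ⟩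
  q * l + q * l + (2 * q + 1) * 1     ≤⟨ +-monoʳ-≤ (q * l + q * l) (*-monoʳ-≤ (2 * q + 1) 1≤l) ⟩
  q * l + q * l + (2 * q + 1) * l     ≡⟨ collect q l ⟩
  suc (4 * q) * l                     ∎
  where
  open ≤-Reasoning
  expand : ∀ q l → suc (q * suc l + q * suc l) ≡ q * l + q * l + (2 * q + 1) * 1
  expand = solve-∀
  collect : ∀ q l → q * l + q * l + (2 * q + 1) * l ≡ suc (4 * q) * l
  collect = solve-∀

theorem1p6 : (α β : ℚ) → 0ℚ ≤ℚ α → 0ℚ ≤ℚ β → 1ℚ <ℚ ((ℕ→ℚ 2 *ℚ α) +ℚ β) →
    ∃[ C ] (C > 0 ×
    ((n : ℕ) → n ≥ 1 → (G : Graph n) → (c : Coloring G n) →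
    (∀ (i : Fin n) → ∃[ e ] (c e ≡ i)) →
    (FM : Subset n) → ℕ→ℚ ∣ FM ∣ ≡ α *ℚ ℕ→ℚ n →
    (∀ i → i ∈ FM → HasMatching2 G c i) →
    (FS : Subset n) → (∀ i → i ∈ FS → i ∉ FM) →
    ℕ→ℚ ∣ FS ∣ ≡ β *ℚ ℕ→ℚ n →
    (∀ i → i ∈ FS → HasStar2 G c i) →
    ∃[ L ] (L ≤ C * ⌊log₂ n ⌋ × RainbowCycle G c L)))
theorem1p6 α β _ _ 1<s with clear-denominator (ℕ→ℚ 2 *ℚ α +ℚ β) 1<s
-- `d` comes from `2α + β` alone, so the constant is fixed before `n` and `G`.
... | d , d≢0 , clear = suc (4 * density d) , s≤s z≤n , λ where
  1 _ G c nonempty _ _ _ _ _ _ _ → contradiction (proj₁ (nonempty zero)) (one-vertex-edgeless G)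
  n@(suc (suc _)) n≥1 G c nonempty FM M≡ matchings FS disjoint S≡ stars →
    map₂ (λ { (L≤ , C) → ≤-trans L≤ (absorb-constant (density d) ⌊log₂ n ⌋ (⌊log₂⌋-mono-≤ {2} {n} (s≤s (s≤s z≤n)))) , C })
      (short-rainbow-cycle G c FM FS nonempty matchings disjoint stars d {{d≢0}} n≥1
        (clear n ∣ FM ∣ ∣ FS ∣ (combine α β M≡ S≡)))
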